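{- Consider the problem of scheduling with uncertain processing times on a single machine with the objective of minimizing the total completion time. For a job $k$ let $r_k$ denote $u_k/t_k$. The expected competitive ratio of the randomized algorithm $\beta$-RPCP with parameter $\beta>0$ is at most $$\max_k\ \frac{(1+\frac1\beta)\,u_k\,(1-\mathbb P_k)+\max\{2t_k+p_k,\ \beta t_k,\ (1+\frac1\beta)(t_k+p_k)\}\,\mathbb P_k}{p_k^*},$$ where $p_k^*=\min\{u_k,t_k+p_k\}$, the maximum is over jobs $k$, and the probability $\mathbb P_k$ with which the algorithm tests job $k$ is $$\mathbb P_k=\frac{(\beta+1)(r_k-1)}{\beta\left(\max\{\frac{2}{r_k}+1,\ \frac{\beta}{r_k},\ (1+\frac1\beta)(1+\frac1{r_k})\}-\max\{2,\ \beta,\ 1+\frac1\beta\}+r_k-1\right)+r_k-1}$$ if $r_k\in[1,3]$, $\mathbb P_k=0$ if $r_k<1$, and $\mathbb P_k=1$ if $r_k>3$.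
   Context: Problem. There are $n$ jobs, all available at time $0$. Job $j$ has a testing time $t_j$, an upper limit $u_j$, and a real processing time $p_j\in[0,u_j]$. A job may be executed untested, which takes $u_j$ time units, or it may be tested (taking $t_j$ time units) and later executed in $p_j$ time units; other tasks may run between the test and the execution. A single machine runs one task at a time. The completion time of a job is the time at which its execution (or execution-untested) ends, and the cost of a schedule is the sum of the completion times of all jobs. An online algorithm knows all $t_j,u_j$ from the start, but learns $p_j$ only when the test of $j$ is finished. $\mathrm{OPT}$ knows all $p_j$ in advance (but must still test $j$ in order to run it in time $p_j$), and its cost is the minimum cost of any schedule; it spends $p_j^*=\min\{u_j,t_j+p_j\}$ on job $j$. The expected competitive ratio of a randomized online algorithm $A$ is the smallest $c$ such that $\mathbb E[\mathrm{cost}(A)]\le c\cdot \mathrm{cost}(\mathrm{OPT})$ on all instances. Algorithm $\beta$-RPCP. Maintain a priority queue of tasks, smaller weight meaning higher priority. Initially, for each job $j$, choose at random: with probability $\mathbb P_j$ insert a testing task of weight $\beta t_j$ (job $j$ is tested), and with probability $1-\mathbb P_j$ insert an execution-untested task of weight $u_j$ (job $j$ is not tested). While the queue is nonempty, extract a task of smallest weight and run it; if it was the testing task of job $j$ (taking $t_j$ time), then after the test insert an execution task for $j$ with weight $t_j+p_j$ (running this execution task takes $p_j$ time).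
   Formalization: Stated for instances with all t_k, u_k > 0 and every P_k in [0,1]; for β > 2 the formula for P_k can leave [0,1] (β = 4, r_k = 3 gives 15), and then the algorithm is undefined. For β ≤ 2 the condition on P_k is automatic. -}

module Defs where

open import Algebra.Bundles using (CommutativeRing)
open import Algebra.Core using (Op₁; Op₂)
open import Algebra.Structures using (IsCommutativeRing)
open import Data.Bool.Base using (Bool; true; false; if_then_else_)
open import Data.Fin.Base using (Fin; zero; suc)
import Data.Fin.Properties as Fin
open import Data.List.Base using (List; []; _∷_; _++_; map; filter; allFin)
open import Data.List.Relation.Binary.Permutation.Propositional using (_↭_)
open import Data.List.Relation.Unary.All using (All)
open import Data.Nat.Base using (ℕ; zero; suc)
open import Data.Product.Base using (_×_; _,_; proj₂)
open import Data.Sum.Base using (_⊎_)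
open import Data.Vec.Base using (Vec; []; _∷_; lookup)
import Data.Vec.Functional as Vector
open import Function.Base using (_∘_)
open import Level using (Level) renaming (_⊔_ to _⊔ˡ_; suc to lsuc)
open import Relation.Binary.Bundles using (DecTotalOrder)
open import Relation.Binary.Core using (Rel)
open import Relation.Binary.PropositionalEquality using (_≡_; _≢_)
open import Relation.Binary.Structures using (IsDecTotalOrder)
open import Relation.Nullary.Decidable using (yes; no)

private
  variable
    n : ℕ

-- The real numbers are represented by an arbitrary totally ordered field.
-- The inverse is total, but nothing is assumed about the value of 0# ⁻¹.
record OrderedField (c ℓ : Level) : Set (lsuc (c ⊔ˡ ℓ)) where
  infix  4 _≤_
  infixl 6 _+_ _-_
  infixl 7 _*_ _/_
  infix  8 -_
  infix  9 _⁻¹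
  field
    Carrier           : Set c
    _≤_               : Rel Carrier ℓ
    _+_ _*_           : Op₂ Carrier
    -_                : Op₁ Carrier
    0# 1#             : Carrier
    _⁻¹               : Op₁ Carrier
    isCommutativeRing : IsCommutativeRing _≡_ _+_ _*_ -_ 0# 1#
    isDecTotalOrder   : IsDecTotalOrder _≡_ _≤_
    0#≢1#             : 0# ≢ 1#
    *-inverseʳ        : ∀ x → x ≢ 0# → x * x ⁻¹ ≡ 1#
    +-monoʳ-≤         : ∀ x {y z} → y ≤ z → x + y ≤ x + z
    *-nonNegative     : ∀ {x y} → 0# ≤ x → 0# ≤ y → 0# ≤ x * y

  commutativeRing : CommutativeRing c c
  commutativeRing = record { isCommutativeRing = isCommutativeRing }

  decTotalOrder : DecTotalOrder c c ℓ
  decTotalOrder = record { isDecTotalOrder = isDecTotalOrder }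

  open import Relation.Binary.Construct.NonStrictToStrict _≡_ _≤_ public
    using () renaming (_<_ to infix 4 _<_)
  open import Algebra.Construct.NaturalChoice.Max
    (DecTotalOrder.totalOrder decTotalOrder) public using (_⊔_)
  open import Algebra.Construct.NaturalChoice.Min
    (DecTotalOrder.totalOrder decTotalOrder) public using (_⊓_)
  open IsDecTotalOrder isDecTotalOrder public using (_≤?_)

  _-_ _/_ : Op₂ Carrier
  x - y = x + - y
  x / y = x * y ⁻¹

  2# 3# : Carrier
  2# = 1# + 1#
  3# = 2# + 1#

  maximum : (Fin (suc n) → Carrier) → Carrier
  maximum f = Vector.foldr _⊔_ (f zero) (f ∘ suc)

data Task (n : ℕ) : Set where
  test execute executeUntested : Fin n → Task n

job : Task n → Fin n
job (test j)            = j
job (execute j)         = j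
job (executeUntested j) = j

module Scheduling {c ℓ} (F : OrderedField c ℓ) where
  open OrderedField F

  record Instance (n : ℕ) : Set (c ⊔ˡ ℓ) where
    field
      t u p : Fin n → Carrier
      0≤t   : ∀ j → 0# ≤ t j
      0≤p   : ∀ j → 0# ≤ p j
      p≤u   : ∀ j → p j ≤ u j

    p* : Fin n → Carrier
    p* j = u j ⊓ (t j + p j)

  -- Tasks in order of execution, each with its starting time.
  Schedule : ℕ → Set c
  Schedule n = List (Carrier × Task n)

  module _ (I : Instance n) where
    open Instance I

    duration : Task n → Carrier
    duration (test j)            = t j
    duration (execute j)         = p j
    duration (executeUntested j) = u j

    completionTime : Carrier × Task n → Carrier
    completionTime (_ , test _) = 0#  -- a test completes no job
    completionTime (s , x)      = s + duration x

    -- In a feasible schedule this is the sum of the completion times of all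
    -- jobs, since each job is then completed by exactly one entry.
    cost : Schedule n → Carrier
    cost []      = 0#
    cost (e ∷ S) = completionTime e + cost S

    -- Sequential τ S: the machine becomes available at time τ and the tasks
    -- of S do not overlap; idle time is allowed.
    data Sequential : Carrier → Schedule n → Set (c ⊔ˡ ℓ) where
      []   : ∀ {τ} → Sequential τ []
      cons : ∀ {τ s x S} → τ ≤ s → Sequential (s + duration x) S →
             Sequential τ ((s , x) ∷ S)

    tasksOf : Fin n → Schedule n → List (Task n)
    tasksOf j S = filter (λ x → job x Fin.≟ j) (map proj₂ S)

    record Feasible (S : Schedule n) : Set (c ⊔ˡ ℓ) where
      field
        sequential : Sequential 0# S
        complete   : ∀ j → tasksOf j S ≡ executeUntested j ∷ []
                         ⊎ tasksOf j S ≡ test j ∷ execute j ∷ []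

    record IsOPT (S : Schedule n) : Set (c ⊔ˡ ℓ) where
      field
        feasible : Feasible S
        minimal  : ∀ S′ → Feasible S′ → cost S ≤ cost S′

  -- Expectation of a function of n independent random bits, the j-th of
  -- which is true with probability P j.
  𝔼 : (Fin n → Carrier) → (Vec Bool n → Carrier) → Carrier
  𝔼 {zero}  P X = X []
  𝔼 {suc n} P X = P zero        * 𝔼 (P ∘ suc) (X ∘ (true ∷_))
                + (1# - P zero) * 𝔼 (P ∘ suc) (X ∘ (false ∷_))

  module RPCP (β : Carrier) (I : Instance n) where
    open Instance I

    weight : Task n → Carrier
    weight (test j)            = β * t j
    weight (execute j)         = t j + p j
    weight (executeUntested j) = u j

    initialQueue : Vec Bool n → List (Task n)
    initialQueue tested =
      map (λ j → if lookup tested j then test j else executeUntested j)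
          (allFin n)

    inserted : Task n → List (Task n)
    inserted (test j)            = execute j ∷ []
    inserted (execute _)         = []
    inserted (executeUntested _) = []

    -- Run τ Q S: started at time τ with queue content Q, the algorithm can
    -- produce S. A relation, because ties between smallest weights are
    -- broken arbitrarily.
    data Run : Carrier → List (Task n) → Schedule n → Set (c ⊔ˡ ℓ) where
      stop : ∀ {τ} → Run τ [] []
      step : ∀ {τ Q x Q′ S} →
             Q ↭ x ∷ Q′ →
             All (λ y → weight x ≤ weight y) Q′ →
             Run (τ + duration I x) (inserted x ++ Q′) S →
             Run τ Q ((τ , x) ∷ S)

    -- The outcome of the algorithm for each result of the random choices
    -- (true: the job is tested), under some way of breaking ties.
    record Execution : Set (c ⊔ˡ ℓ) where
      field
        schedule : Vec Bool n → Schedule n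
        isRun    : ∀ tested → Run 0# (initialQueue tested) (schedule tested)

    r : Fin n → Carrier
    r k = u k / t k

    ℙ-middle : Carrier → Carrier
    ℙ-middle ρ =
      ((β + 1#) * (ρ - 1#)) /
      (β * (((2# / ρ + 1#) ⊔ (β / ρ) ⊔ ((1# + 1# / β) * (1# + 1# / ρ)))
            - (2# ⊔ β ⊔ (1# + 1# / β))
            + ρ - 1#)
       + ρ - 1#)

    ℙ : Fin n → Carrier
    ℙ k with 1# ≤? r k | r k ≤? 3#
    ... | no _  | _     = 0#
    ... | yes _ | no _  = 1#
    ... | yes _ | yes _ = ℙ-middle (r k)

    expectedCost : Execution → Carrier
    expectedCost A = 𝔼 ℙ (cost I ∘ Execution.schedule A)

    jobRatio : Fin n → Carrier
    jobRatio k =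
      ((1# + 1# / β) * u k * (1# - ℙ k)
       + ((2# * t k + p k) ⊔ (β * t k) ⊔ ((1# + 1# / β) * (t k + p k))) * ℙ k)
      / p* k

{-# OPTIONS --safe #-}
module Submission where

open import Defs
open import Algebra.Bundles using (CommutativeRing)
import Algebra.Construct.NaturalChoice.Max as Max
import Algebra.Construct.NaturalChoice.Min as Min
import Algebra.Properties.Ring as RingProperties
import Algebra.Solver.Ring.NaturalCoefficients.Default as NaturalCoefficients
open import Data.Bool.Base using (Bool; true; false; if_then_else_)
open import Data.Fin.Base using (Fin; zero; suc)
import Data.Fin.Properties as Fin
open import Data.List.Base using (List; []; _∷_; _++_; map; allFin)
open import Data.List.Membership.DecPropositional using () renaming (_∈?_ to member?)
open import Data.List.Membership.Propositional using (_∈_; _∉_)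
open import Data.List.Membership.Propositional.Properties using (∈-allFin; ∈-∃++)
open import Data.List.Properties using (filter-accept; filter-reject; ∷-injectiveʳ)
open import Data.List.Relation.Binary.Permutation.Propositional
  using (_↭_; refl; prep; swap; trans; ↭-sym; ↭⇒↭ₛ)
open import Data.List.Relation.Binary.Permutation.Propositional.Properties
  using (shift; ∈-resp-↭)
import Data.List.Relation.Binary.Permutation.Setoid.Properties as Permutation
open import Data.List.Relation.Unary.All as All using (All; []; _∷_)
open import Data.List.Relation.Unary.AllPairs as AllPairs using (AllPairs; []; _∷_)
import Data.List.Relation.Unary.AllPairs.Properties as AllPairs
open import Data.List.Relation.Unary.Any using (here; there)
open import Data.List.Relation.Unary.Unique.Propositional using (Unique)
open import Data.List.Relation.Unary.Unique.Propositional.Properties using (allFin⁺)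
open import Data.Nat.Base using (ℕ; zero; suc)
open import Data.Product.Base using (∃-syntax; _×_; _,_; proj₁; proj₂)
open import Data.Sum.Base using (inj₁; inj₂)
open import Data.Vec.Base using (Vec; []; _∷_; lookup)
import Data.Vec.Functional as Vector
open import Function.Base using (_∘_; id)
open import Level using (Level) renaming (_⊔_ to _⊔ˡ_)
open import Relation.Binary.Bundles using (DecTotalOrder)
import Relation.Binary.Reasoning.PartialOrder as PartialOrderReasoning
open import Relation.Binary.PropositionalEquality as ≡
  using (_≡_; _≢_; refl; cong; cong₂; sym; subst; resp₂; setoid)
open import Relation.Nullary.Decidable using (yes; no)
open import Relation.Nullary.Negation using (contradiction)

-- Let q_k be the random variable (1 + 1/β) u_k if job k is not tested and
-- max {2 t_k + p_k, β t_k, (1 + 1/β) (t_k + p_k)} if it is.  Whatever the random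
-- choices and the processing times, the work of two jobs i and j that delays the
-- other one adds up to at most min (q_i, q_j), and job k delays itself by at most
-- q_k, so the cost is at most Σ q_k + Σ_{i<j} min (q_i, q_j).  Taking expectations,
-- E min (q_i, q_j) ≤ min (E q_i, E q_j), and E q_k is jobRatio k times p*_k, while
-- every feasible schedule costs at least Σ p*_k + Σ_{i<j} min (p*_i, p*_j).

-- Arithmetic of ordered fields.

module OrderedFieldProperties {c ℓ : Level} (F : OrderedField c ℓ) where
  open OrderedField F
  open CommutativeRing commutativeRing public
    using (+-comm; +-assoc; +-identityˡ; +-identityʳ; -‿inverseˡ; -‿inverseʳ;
           *-comm; *-assoc; *-identityˡ; *-identityʳ; distribˡ; distribʳ; zeroˡ; zeroʳ)
  open DecTotalOrder decTotalOrder public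
    using (totalOrder; poset) renaming
    (refl to ≤-refl; reflexive to ≤-reflexive; trans to ≤-trans; antisym to ≤-antisym;
     total to ≤-total)
  open Max totalOrder public using (x≤x⊔y; x≤y⊔x; ⊔-sel)
  open Min totalOrder public using (x⊓y≤x; x⊓y≤y; ⊓-sel; ⊓-comm; ⊓-mono-≤; ⊓-glb)
  open NaturalCoefficients (CommutativeRing.commutativeSemiring commutativeRing) public
    using (solve; _:=_; _:+_; _:*_)
  open RingProperties (CommutativeRing.ring commutativeRing) using (-1*x≈-x; -‿involutive)
  open PartialOrderReasoning poset

  private
    variable
      a : Level
      A : Set a

  +-mono-≤ : ∀ {w x y z} → w ≤ x → y ≤ z → w + y ≤ x + z
  +-mono-≤ {w} {x} {y} {z} w≤x y≤z = begin
    w + y  ≡⟨ +-comm w y ⟩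
    y + w  ≤⟨ +-monoʳ-≤ y w≤x ⟩
    y + x  ≡⟨ +-comm y x ⟩
    x + y  ≤⟨ +-monoʳ-≤ x y≤z ⟩
    x + z  ∎

  +-monoˡ-≤ : ∀ z {x y} → x ≤ y → x + z ≤ y + z
  +-monoˡ-≤ z x≤y = +-mono-≤ x≤y ≤-refl

  x+y-y≡x : ∀ x y → x + y - y ≡ x
  x+y-y≡x x y = ≡.trans (+-assoc x y (- y)) (≡.trans (cong (x +_) (-‿inverseʳ y)) (+-identityʳ x))

  +-cancelʳ-≤ : ∀ z {x y} → x + z ≤ y + z → x ≤ y
  +-cancelʳ-≤ z {x} {y} le = begin
    x          ≡⟨ x+y-y≡x x z ⟨
    x + z - z  ≤⟨ +-monoˡ-≤ (- z) le ⟩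
    y + z - z  ≡⟨ x+y-y≡x y z ⟩
    y          ∎

  x≤x+y : ∀ {x y} → 0# ≤ y → x ≤ x + y
  x≤x+y {x} 0≤y = ≤-trans (≤-reflexive (sym (+-identityʳ x))) (+-monoʳ-≤ x 0≤y)

  x≤y+x : ∀ {x y} → 0# ≤ y → x ≤ y + x
  x≤y+x {x} {y} 0≤y = ≤-trans (x≤x+y 0≤y) (≤-reflexive (+-comm x y))

  +-nonNegative : ∀ {x y} → 0# ≤ x → 0# ≤ y → 0# ≤ x + y
  +-nonNegative 0≤x 0≤y = ≤-trans 0≤x (x≤x+y 0≤y)

  x≤y⇒0≤y-x : ∀ {x y} → x ≤ y → 0# ≤ y - x
  x≤y⇒0≤y-x {x} x≤y = ≤-trans (≤-reflexive (sym (-‿inverseʳ x))) (+-monoˡ-≤ (- x) x≤y)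

  x+[y-x]≡y : ∀ x y → x + (y - x) ≡ y
  x+[y-x]≡y x y = ≡.trans (+-comm x _) (≡.trans (+-assoc y (- x) x)
    (≡.trans (cong (y +_) (-‿inverseˡ x)) (+-identityʳ y)))

  *-monoˡ-≤ : ∀ {z x y} → 0# ≤ z → x ≤ y → z * x ≤ z * y
  *-monoˡ-≤ {z} {x} {y} 0≤z x≤y = begin
    z * x                ≤⟨ x≤x+y (*-nonNegative 0≤z (x≤y⇒0≤y-x x≤y)) ⟩
    z * x + z * (y - x)  ≡⟨ distribˡ z x (y - x) ⟨
    z * (x + (y - x))    ≡⟨ cong (z *_) (x+[y-x]≡y x y) ⟩
    z * y                ∎

  *-monoʳ-≤ : ∀ {z x y} → 0# ≤ z → x ≤ y → x * z ≤ y * z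
  *-monoʳ-≤ {z} {x} {y} 0≤z x≤y = begin
    x * z  ≡⟨ *-comm x z ⟩
    z * x  ≤⟨ *-monoˡ-≤ 0≤z x≤y ⟩
    z * y  ≡⟨ *-comm z y ⟩
    y * z  ∎

  x≤0⇒0≤-x : ∀ {x} → x ≤ 0# → 0# ≤ - x
  x≤0⇒0≤-x {x} x≤0 = ≤-trans (x≤y⇒0≤y-x x≤0) (≤-reflexive (+-identityˡ (- x)))

  0≤1 : 0# ≤ 1#
  0≤1 with ≤-total 0# 1#
  ... | inj₁ 0≤1 = 0≤1
  ... | inj₂ 1≤0 = begin
    0#           ≤⟨ *-nonNegative (x≤0⇒0≤-x 1≤0) (x≤0⇒0≤-x 1≤0) ⟩
    - 1# * - 1#  ≡⟨ -1*x≈-x (- 1#) ⟩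
    - - 1#       ≡⟨ -‿involutive 1# ⟩
    1#           ∎

  *-inverseˡ : ∀ {x} → 0# < x → x ⁻¹ * x ≡ 1#
  *-inverseˡ {x} (_ , 0≢x) = ≡.trans (*-comm (x ⁻¹) x) (*-inverseʳ x (0≢x ∘ sym))

  ⁻¹-nonNegative : ∀ {x} → 0# < x → 0# ≤ x ⁻¹
  ⁻¹-nonNegative {x} 0<x with ≤-total 0# (x ⁻¹)
  ... | inj₁ 0≤x⁻¹ = 0≤x⁻¹
  ... | inj₂ x⁻¹≤0 = contradiction (≤-antisym 0≤1 1≤0) 0#≢1#
    where
    1≤0 : 1# ≤ 0#
    1≤0 = begin
      1#        ≡⟨ *-inverseˡ 0<x ⟨
      x ⁻¹ * x  ≤⟨ *-monoʳ-≤ (proj₁ 0<x) x⁻¹≤0 ⟩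
      0# * x    ≡⟨ zeroˡ x ⟩
      0#        ∎

  x/y*y≡x : ∀ x {y} → 0# < y → x / y * y ≡ x
  x/y*y≡x x {y} 0<y = ≡.trans (*-assoc x (y ⁻¹) y)
    (≡.trans (cong (x *_) (*-inverseˡ 0<y)) (*-identityʳ x))

  -- The quotient has the form `1# / x * z` because the bounds for the algorithm contain the
  -- coefficient `1# / β`.
  x*y≤z⇒y≤z/x : ∀ {x y z} → 0# < x → x * y ≤ z → y ≤ 1# / x * z
  x*y≤z⇒y≤z/x {x} {y} {z} 0<x x*y≤z = begin
    y                ≡⟨ *-identityˡ y ⟨
    1# * y           ≡⟨ cong (_* y) (x/y*y≡x 1# 0<x) ⟨
    1# / x * x * y   ≡⟨ *-assoc (1# / x) x y ⟩
    1# / x * (x * y) ≤⟨ *-monoˡ-≤ (*-nonNegative 0≤1 (⁻¹-nonNegative 0<x)) x*y≤z ⟩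
    1# / x * z       ∎

  *-cancelˡ-≤ : ∀ {x y z} → 0# < x → x * y ≤ x * z → y ≤ z
  *-cancelˡ-≤ {x} {y} {z} 0<x le = begin
    y                 ≤⟨ x*y≤z⇒y≤z/x 0<x le ⟩
    1# / x * (x * z)  ≡⟨ *-assoc (1# / x) x z ⟨
    1# / x * x * z    ≡⟨ cong (_* z) (x/y*y≡x 1# 0<x) ⟩
    1# * z            ≡⟨ *-identityˡ z ⟩
    z                 ∎

  2#*x≡x+x : ∀ x → 2# * x ≡ x + x
  2#*x≡x+x x = ≡.trans (distribʳ x 1# 1#) (cong₂ _+_ (*-identityˡ x) (*-identityˡ x))

  -- `maximum` folds from the value at `zero`, so the induction has to carry an arbitrary starting
  -- value `z`.
  foldr-⊔-upper : ∀ {n} z (xs : Vector.Vector Carrier n) →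
                  z ≤ Vector.foldr _⊔_ z xs × (∀ i → xs i ≤ Vector.foldr _⊔_ z xs)
  foldr-⊔-upper {zero}  z xs = ≤-refl , λ ()
  foldr-⊔-upper {suc n} z xs with foldr-⊔-upper z (xs ∘ suc)
  ... | z≤ , xs≤ = ≤-trans z≤ (x≤y⊔x _ _) , λ where
    zero    → x≤x⊔y _ _
    (suc i) → ≤-trans (xs≤ i) (x≤y⊔x _ _)

  f≤maximum : ∀ {n} (f : Fin (suc n) → Carrier) k → f k ≤ maximum f
  f≤maximum f zero    = proj₁ (foldr-⊔-upper (f zero) (f ∘ suc))
  f≤maximum f (suc k) = proj₂ (foldr-⊔-upper (f zero) (f ∘ suc)) k

  -- Sums over the entries and over the unordered pairs of a list.

  sum : (A → Carrier) → List A → Carrier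
  sum f []       = 0#
  sum f (x ∷ xs) = f x + sum f xs

  -- Unordered pairs: f x y is counted only for x before y in the list.
  pairSum : (A → A → Carrier) → List A → Carrier
  pairSum f []       = 0#
  pairSum f (x ∷ xs) = sum (f x) xs + pairSum f xs

  -- The optimal total completion time when entry x takes time f x.
  total : (A → Carrier) → List A → Carrier
  total f xs = sum f xs + pairSum (λ x y → f x ⊓ f y) xs

  sum-mono : ∀ {f g : A → Carrier} {xs} → All (λ x → f x ≤ g x) xs → sum f xs ≤ sum g xs
  sum-mono []         = ≤-refl
  sum-mono (le ∷ les) = +-mono-≤ le (sum-mono les)

  sum-cong : ∀ {f g : A → Carrier} {xs} → All (λ x → f x ≡ g x) xs → sum f xs ≡ sum g xs
  sum-cong []         = refl
  sum-cong (eq ∷ eqs) = cong₂ _+_ eq (sum-cong eqs)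

  interchange : ∀ w x y z → w + x + (y + z) ≡ w + y + (x + z)
  interchange = solve 4 (λ w x y z → w :+ x :+ (y :+ z) := w :+ y :+ (x :+ z)) refl

  sum-+ : ∀ (f g : A → Carrier) xs → sum (λ x → f x + g x) xs ≡ sum f xs + sum g xs
  sum-+ f g []       = sym (+-identityˡ 0#)
  sum-+ f g (x ∷ xs) = ≡.trans (cong (f x + g x +_) (sum-+ f g xs)) (interchange _ _ _ _)

  sum-* : ∀ c (f : A → Carrier) xs → sum (λ x → c * f x) xs ≡ c * sum f xs
  sum-* c f []       = sym (zeroʳ c)
  sum-* c f (x ∷ xs) = ≡.trans (cong (c * f x +_) (sum-* c f xs)) (sym (distribˡ c _ _))

  sum-zero : ∀ (xs : List A) → sum (λ _ → 0#) xs ≡ 0#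
  sum-zero []       = refl
  sum-zero (x ∷ xs) = ≡.trans (+-identityˡ _) (sum-zero xs)

  sum-nonNegative : ∀ {f : A → Carrier} → (∀ x → 0# ≤ f x) → ∀ xs → 0# ≤ sum f xs
  sum-nonNegative 0≤f []       = ≤-refl
  sum-nonNegative 0≤f (x ∷ xs) = +-nonNegative (0≤f x) (sum-nonNegative 0≤f xs)

  sum-map : ∀ {b} {B : Set b} (f : B → Carrier) (g : A → B) xs →
            sum f (map g xs) ≡ sum (f ∘ g) xs
  sum-map f g []       = refl
  sum-map f g (x ∷ xs) = cong (f (g x) +_) (sum-map f g xs)

  sum-↭ : ∀ (f : A → Carrier) {xs ys} → xs ↭ ys → sum f xs ≡ sum f ys
  sum-↭ f refl                     = refl
  sum-↭ f (prep x xs↭ys)           = cong (f x +_) (sum-↭ f xs↭ys)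
  sum-↭ f {ys = _ ∷ _ ∷ ys} (swap x y xs↭ys) = ≡.trans
    (cong (λ s → f x + (f y + s)) (sum-↭ f xs↭ys))
    (solve 3 (λ a b c → a :+ (b :+ c) := b :+ (a :+ c)) refl (f x) (f y) (sum f ys))
  sum-↭ f (trans xs↭ys ys↭zs)      = ≡.trans (sum-↭ f xs↭ys) (sum-↭ f ys↭zs)

  pairSum-mono : ∀ {f g : A → A → Carrier} → (∀ x y → f x y ≤ g x y) → ∀ xs →
                 pairSum f xs ≤ pairSum g xs
  pairSum-mono f≤g []       = ≤-refl
  pairSum-mono f≤g (x ∷ xs) =
    +-mono-≤ (sum-mono (All.universal (f≤g x) xs)) (pairSum-mono f≤g xs)

  pairSum-* : ∀ c (f : A → A → Carrier) xs →
              pairSum (λ x y → c * f x y) xs ≡ c * pairSum f xs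
  pairSum-* c f []       = sym (zeroʳ c)
  pairSum-* c f (x ∷ xs) =
    ≡.trans (cong₂ _+_ (sum-* c (f x) xs) (pairSum-* c f xs)) (sym (distribˡ c _ _))

  pairSum-nonNegative : ∀ {f : A → A → Carrier} → (∀ x y → 0# ≤ f x y) → ∀ xs →
                        0# ≤ pairSum f xs
  pairSum-nonNegative 0≤f []       = ≤-refl
  pairSum-nonNegative 0≤f (x ∷ xs) =
    +-nonNegative (sum-nonNegative (0≤f x) xs) (pairSum-nonNegative 0≤f xs)

  pairSum-map : ∀ {b} {B : Set b} (f : B → B → Carrier) (g : A → B) xs →
                pairSum f (map g xs) ≡ pairSum (λ x y → f (g x) (g y)) xs
  pairSum-map f g []       = refl
  pairSum-map f g (x ∷ xs) = cong₂ _+_ (sum-map (f (g x)) g xs) (pairSum-map f g xs)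

  pairSum-↭ : ∀ {f : A → A → Carrier} → (∀ x y → f x y ≡ f y x) → ∀ {xs ys} → xs ↭ ys →
              pairSum f xs ≡ pairSum f ys
  pairSum-↭ f-sym refl                = refl
  pairSum-↭ {f = f} f-sym (prep x xs↭ys) = cong₂ _+_ (sum-↭ (f x) xs↭ys) (pairSum-↭ f-sym xs↭ys)
  pairSum-↭ {f = f} f-sym {ys = _ ∷ _ ∷ ys} (swap x y xs↭ys) = ≡.trans
    (cong₂ _+_ (cong₂ _+_ (f-sym x y) (sum-↭ (f x) xs↭ys))
               (cong₂ _+_ (sum-↭ (f y) xs↭ys) (pairSum-↭ f-sym xs↭ys)))
    (interchange (f y x) (sum (f x) ys) (sum (f y) ys) (pairSum f ys))
  pairSum-↭ f-sym (trans xs↭ys ys↭zs) = ≡.trans (pairSum-↭ f-sym xs↭ys) (pairSum-↭ f-sym ys↭zs)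

  total-mono : ∀ {f g : A → Carrier} → (∀ x → f x ≤ g x) → ∀ xs → total f xs ≤ total g xs
  total-mono f≤g xs = +-mono-≤ (sum-mono (All.universal f≤g xs))
    (pairSum-mono (λ x y → ⊓-mono-≤ (f≤g x) (f≤g y)) xs)

  total-map : ∀ {b} {B : Set b} (f : B → Carrier) (g : A → B) xs →
              total f (map g xs) ≡ total (f ∘ g) xs
  total-map f g xs = cong₂ _+_ (sum-map f g xs) (pairSum-map _ g xs)

  -- For every sign of `c`, the value `c * (x ⊓ y)` is one of `c * x` and `c * y`, hence at least
  -- their minimum.
  total-*-≤ : ∀ c (f : A → Carrier) xs → total (λ x → c * f x) xs ≤ c * total f xs
  total-*-≤ c f xs = begin
    total (λ x → c * f x) xs
      ≤⟨ +-monoʳ-≤ _ (pairSum-mono (λ x y → *-⊓-≤ (f x) (f y)) xs) ⟩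
    sum (λ x → c * f x) xs + pairSum (λ x y → c * (f x ⊓ f y)) xs
      ≡⟨ cong₂ _+_ (sum-* c f xs) (pairSum-* c _ xs) ⟩
    c * sum f xs + c * pairSum (λ x y → f x ⊓ f y) xs
      ≡⟨ distribˡ c _ _ ⟨
    c * total f xs ∎
    where
    *-⊓-≤ : ∀ x y → (c * x) ⊓ (c * y) ≤ c * (x ⊓ y)
    *-⊓-≤ x y with ⊓-sel x y
    ... | inj₁ eq = ≤-trans (x⊓y≤x _ _) (≤-reflexive (cong (c *_) (sym eq)))
    ... | inj₂ eq = ≤-trans (x⊓y≤y _ _) (≤-reflexive (cong (c *_) (sym eq)))

-- Expectations over independent random bits.

module Expectation {c ℓ : Level} (F : OrderedField c ℓ) where
  open OrderedField F
  open OrderedFieldProperties F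
  open Scheduling F using (𝔼)

  private
    variable
      a : Level
      A : Set a
      n : ℕ

  convex-const : ∀ p x → p * x + (1# - p) * x ≡ x
  convex-const p x = ≡.trans (sym (distribʳ x p (1# - p)))
    (≡.trans (cong (_* x) (x+[y-x]≡y p 1#)) (*-identityˡ x))

  𝔼-const : ∀ (P : Fin n → Carrier) x → 𝔼 P (λ _ → x) ≡ x
  𝔼-const {zero}  P x = refl
  𝔼-const {suc n} P x = ≡.trans
    (cong (λ e → P zero * e + (1# - P zero) * e) (𝔼-const (P ∘ suc) x)) (convex-const (P zero) x)

  -- Bits before the `j`-th have no influence: both outcomes of such a bit lead to the same
  -- expectation, and their weights add up to 1. The bits after it average a constant.
  𝔼-lookup : ∀ (P : Fin n → Carrier) (f : Bool → Carrier) j →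
             𝔼 P (λ v → f (lookup v j)) ≡ P j * f true + (1# - P j) * f false
  𝔼-lookup P f zero    = cong₂ (λ x y → P zero * x + (1# - P zero) * y)
    (𝔼-const (P ∘ suc) (f true)) (𝔼-const (P ∘ suc) (f false))
  𝔼-lookup P f (suc j) = ≡.trans
    (cong (λ e → P zero * e + (1# - P zero) * e) (𝔼-lookup (P ∘ suc) f j))
    (convex-const (P zero) _)

  𝔼-+ : ∀ (P : Fin n → Carrier) X Y → 𝔼 P (λ v → X v + Y v) ≡ 𝔼 P X + 𝔼 P Y
  𝔼-+ {zero}  P X Y = refl
  𝔼-+ {suc n} P X Y = ≡.trans
    (cong₂ (λ x y → P zero * x + (1# - P zero) * y)
      (𝔼-+ (P ∘ suc) (X ∘ (true ∷_)) (Y ∘ (true ∷_)))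
      (𝔼-+ (P ∘ suc) (X ∘ (false ∷_)) (Y ∘ (false ∷_))))
    (solve 6 (λ p q w x y z → p :* (w :+ x) :+ q :* (y :+ z) :=
                              p :* w :+ q :* y :+ (p :* x :+ q :* z))
      refl (P zero) (1# - P zero) _ _ _ _)

  𝔼-mono : ∀ {P : Fin n → Carrier} {X Y} → (∀ k → 0# ≤ P k × P k ≤ 1#) →
           (∀ v → X v ≤ Y v) → 𝔼 P X ≤ 𝔼 P Y
  𝔼-mono {zero}  bounds X≤Y = X≤Y []
  𝔼-mono {suc n} bounds X≤Y = +-mono-≤
    (*-monoˡ-≤ (proj₁ (bounds zero)) (𝔼-mono (bounds ∘ suc) (X≤Y ∘ (true ∷_))))
    (*-monoˡ-≤ (x≤y⇒0≤y-x (proj₂ (bounds zero))) (𝔼-mono (bounds ∘ suc) (X≤Y ∘ (false ∷_))))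

  𝔼-sum : ∀ (P : Fin n → Carrier) (X : Vec Bool n → A → Carrier) xs →
          𝔼 P (λ v → sum (X v) xs) ≡ sum (λ x → 𝔼 P (λ v → X v x)) xs
  𝔼-sum P X []       = 𝔼-const P 0#
  𝔼-sum P X (x ∷ xs) = ≡.trans (𝔼-+ P _ _) (cong (𝔼 P (λ v → X v x) +_) (𝔼-sum P X xs))

  𝔼-pairSum : ∀ (P : Fin n → Carrier) (X : Vec Bool n → A → A → Carrier) xs →
              𝔼 P (λ v → pairSum (X v) xs) ≡ pairSum (λ x y → 𝔼 P (λ v → X v x y)) xs
  𝔼-pairSum P X []       = 𝔼-const P 0#
  𝔼-pairSum P X (x ∷ xs) = ≡.trans (𝔼-+ P _ _)
    (cong₂ _+_ (𝔼-sum P (λ v → X v x) xs) (𝔼-pairSum P X xs))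

  -- Linearity handles both sums, and only the minima lose something: for every outcome a minimum
  -- lies below each of its arguments, so by monotonicity its expectation lies below both
  -- expectations.
  𝔼-total : ∀ {P : Fin n → Carrier} → (∀ k → 0# ≤ P k × P k ≤ 1#) →
            ∀ (X : Vec Bool n → A → Carrier) xs →
            𝔼 P (λ v → total (X v) xs) ≤ total (λ x → 𝔼 P (λ v → X v x)) xs
  𝔼-total {P = P} bounds X xs = ≤-trans
    (≤-reflexive (≡.trans (𝔼-+ P _ _) (cong₂ _+_ (𝔼-sum P X xs) (𝔼-pairSum P _ xs))))
    (+-monoʳ-≤ _ (pairSum-mono (λ x y → ⊓-glb
      (𝔼-mono bounds (λ v → x⊓y≤x (X v x) (X v y)))
      (𝔼-mono bounds (λ v → x⊓y≤y (X v x) (X v y)))) xs))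

-- The lower bound on the cost of every feasible schedule.

module OptimumLowerBound {c ℓ : Level} (F : OrderedField c ℓ) {n : ℕ}
                         (I : Scheduling.Instance F n) where
  open OrderedField F
  open OrderedFieldProperties F
  open Scheduling F
  open Instance I
  open PartialOrderReasoning poset

  -- The first two shapes are those of a feasible schedule; `pending` arises from `tested` once the
  -- test has been run.
  data Plan (j : Fin n) (xs : List (Task n)) : Set where
    untested : xs ≡ executeUntested j ∷ []     → Plan j xs
    tested   : xs ≡ test j ∷ execute j ∷ []    → Plan j xs
    pending  : xs ≡ execute j ∷ []             → Plan j xs

  -- Time already spent on the test of a job, read off from its remaining tasks.
  credit : List (Task n) → Carrier
  credit (execute j ∷ _) = t j
  credit _               = 0#

  credit-nonNegative : ∀ xs → 0# ≤ credit xs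
  credit-nonNegative []                      = ≤-refl
  credit-nonNegative (test _ ∷ _)            = ≤-refl
  credit-nonNegative (execute j ∷ _)         = 0≤t j
  credit-nonNegative (executeUntested _ ∷ _) = ≤-refl

  tasksOf-accept : ∀ s x (S : Schedule n) →
                   tasksOf I (job x) ((s , x) ∷ S) ≡ x ∷ tasksOf I (job x) S
  tasksOf-accept s x S = filter-accept (λ y → job y Fin.≟ job x) refl

  tasksOf-reject : ∀ {j} s x (S : Schedule n) → job x ≢ j →
                   tasksOf I j ((s , x) ∷ S) ≡ tasksOf I j S
  tasksOf-reject {j} s x S = filter-reject (λ y → job y Fin.≟ j) {x} {map proj₂ S}

  -- This is the cost of running the jobs of `Q` without gaps from time `a` on, each for time `p*`,
  -- shortest first.
  lowerBound : Carrier → List (Fin n) → Carrier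
  lowerBound a Q = sum (λ j → a + p* j) Q + pairSum (λ i j → p* i ⊓ p* j) Q

  lowerBound-↭ : ∀ {a Q Q′} → Q ↭ Q′ → lowerBound a Q ≡ lowerBound a Q′
  lowerBound-↭ Q↭Q′ = cong₂ _+_ (sum-↭ _ Q↭Q′) (pairSum-↭ (λ i j → ⊓-comm (p* i) (p* j)) Q↭Q′)

  -- If `i` is the next job to finish, it delays every other job `j` by `p* i`, whereas the pair is
  -- charged only `p* i ⊓ p* j`.
  lowerBound-∷ : ∀ {a i} Q → lowerBound a (i ∷ Q) ≤ a + p* i + lowerBound (a + p* i) Q
  lowerBound-∷ {a} {i} Q = begin
    a + p* i + sum (λ j → a + p* j) Q + (sum (λ j → p* i ⊓ p* j) Q + R)
      ≡⟨ solve 4 (λ x y z w → x :+ y :+ (z :+ w) := x :+ (y :+ z :+ w)) refl (a + p* i) _ _ R ⟩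
    a + p* i + (sum (λ j → a + p* j) Q + sum (λ j → p* i ⊓ p* j) Q + R)
      ≡⟨ cong (λ s → a + p* i + (s + R)) (sum-+ _ _ Q) ⟨
    a + p* i + (sum (λ j → a + p* j + p* i ⊓ p* j) Q + R)
      ≤⟨ +-monoʳ-≤ _ (+-monoˡ-≤ R (sum-mono (All.universal pointwise Q))) ⟩
    a + p* i + lowerBound (a + p* i) Q ∎
    where
    R = pairSum (λ i j → p* i ⊓ p* j) Q
    pointwise : ∀ j → a + p* j + p* i ⊓ p* j ≤ a + p* i + p* j
    pointwise j = begin
      a + p* j + p* i ⊓ p* j ≤⟨ +-monoʳ-≤ _ (x⊓y≤x _ _) ⟩
      a + p* j + p* i        ≡⟨ solve 3 (λ x y z → x :+ y :+ z := x :+ z :+ y) refl a (p* j) (p* i) ⟩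
      a + p* i + p* j        ∎

  -- The jobs of Q are the unfinished ones; a is the total p* of the finished ones.
  record Pending (a τ : Carrier) (Q : List (Fin n)) (S : Schedule n) : Set (c ⊔ˡ ℓ) where
    field
      unique  : Unique Q
      plan    : ∀ {j} → j ∈ Q → Plan j (tasksOf I j S)
      absent  : ∀ {j} → j ∉ Q → tasksOf I j S ≡ []
      elapsed : a + sum (λ j → credit (tasksOf I j S)) Q ≤ τ

  open Pending

  Pending-↭ : ∀ {a τ Q Q′ S} → Q ↭ Q′ → Pending a τ Q S → Pending a τ Q′ S
  Pending-↭ {a} {S = S} Q↭Q′ pend = record
    { unique  = Permutation.Unique-resp-↭ (setoid _) (↭⇒↭ₛ Q↭Q′) (unique pend)
    ; plan    = λ j∈ → plan pend (∈-resp-↭ (↭-sym Q↭Q′) j∈)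
    ; absent  = λ j∉ → absent pend (λ j∈ → j∉ (∈-resp-↭ Q↭Q′ j∈))
    ; elapsed = ≤-trans (≤-reflexive (cong (a +_)
        (sum-↭ (λ j → credit (tasksOf I j S)) (↭-sym Q↭Q′)))) (elapsed pend)
    }

  module _ {a τ s x Q S} (τ≤s : τ ≤ s) (pend : Pending a τ (job x ∷ Q) ((s , x) ∷ S)) where
    private
      fresh : ∀ {j} → j ∈ Q → job x ≢ j
      fresh = All.lookup (AllPairs.head (unique pend))

      rest : Carrier
      rest = sum (λ j → credit (tasksOf I j S)) Q

      -- Dropping the entry of `x` leaves the tasks of the other jobs unchanged, and the credit of
      -- the job of `x` depends only on its first task `x`.
      elapsed-rest : a + (credit (x ∷ []) + rest) ≤ s
      elapsed-rest = begin
        a + (credit (x ∷ []) + rest)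
          ≡⟨ cong (a +_) (cong₂ _+_ (≡.trans (credit-head x) (cong credit (sym (tasksOf-accept s x S))))
              (sum-cong (All.tabulate (λ j∈ → cong credit (sym (tasksOf-reject s x S (fresh j∈))))))) ⟩
        a + sum (λ j → credit (tasksOf I j ((s , x) ∷ S))) (job x ∷ Q)
          ≤⟨ elapsed pend ⟩
        τ ≤⟨ τ≤s ⟩
        s ∎
        where
        credit-head : ∀ x {xs} → credit (x ∷ []) ≡ credit (x ∷ xs)
        credit-head (test _)            = refl
        credit-head (execute _)         = refl
        credit-head (executeUntested _) = refl

      plan-rest : ∀ {j} → j ∈ Q → Plan j (tasksOf I j S)
      plan-rest j∈ = subst (Plan _) (tasksOf-reject s x S (fresh j∈)) (plan pend (there j∈))

      absent-rest : ∀ {j} → j ∉ job x ∷ Q → tasksOf I j S ≡ []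
      absent-rest j∉ = ≡.trans (sym (tasksOf-reject s x S (λ eq → j∉ (here (sym eq))))) (absent pend j∉)

    plan-head : Plan (job x) (x ∷ tasksOf I (job x) S)
    plan-head = subst (Plan (job x)) (tasksOf-accept s x S) (plan pend (here refl))

    -- The credit of the finished job leaves the sum over `Q`. Together with the duration of `x` it
    -- covers the amount `p*` that is added to `a`.
    Pending-finish : tasksOf I (job x) S ≡ [] → p* (job x) ≤ credit (x ∷ []) + duration I x →
                     Pending (a + p* (job x)) (s + duration I x) Q S
    Pending-finish done p*≤ = record
      { unique  = AllPairs.tail (unique pend)
      ; plan    = plan-rest
      ; absent  = absent-finish
      ; elapsed = begin
          a + p* (job x) + rest
            ≤⟨ +-monoˡ-≤ rest (+-monoʳ-≤ a p*≤) ⟩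
          a + (credit (x ∷ []) + duration I x) + rest
            ≡⟨ solve 4 (λ a b c d → a :+ (b :+ c) :+ d := a :+ (b :+ d) :+ c) refl a _ _ rest ⟩
          a + (credit (x ∷ []) + rest) + duration I x
            ≤⟨ +-monoˡ-≤ _ elapsed-rest ⟩
          s + duration I x ∎
      }
      where
      absent-finish : ∀ {j} → j ∉ Q → tasksOf I j S ≡ []
      absent-finish {j} j∉Q with job x Fin.≟ j
      ... | yes refl = done
      ... | no  x≢j  = absent-rest λ { (here eq) → x≢j (sym eq) ; (there j∈Q) → j∉Q j∈Q }

    -- The time taken by the test is booked as credit of its job, so `a` and `Q` stay as they are.
    Pending-test : credit (x ∷ []) ≡ 0# → credit (tasksOf I (job x) S) ≡ duration I x →
                   Plan (job x) (tasksOf I (job x) S) →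
                   Pending a (s + duration I x) (job x ∷ Q) S
    Pending-test credit-before credit-after plan-x = record
      { unique  = unique pend
      ; plan    = λ { (here refl) → plan-x ; (there j∈) → plan-rest j∈ }
      ; absent  = absent-rest
      ; elapsed = begin
          a + (credit (tasksOf I (job x) S) + rest)
            ≡⟨ cong (λ z → a + (z + rest)) credit-after ⟩
          a + (duration I x + rest)
            ≡⟨ solve 3 (λ a b c → a :+ (b :+ c) := a :+ c :+ b) refl a _ rest ⟩
          a + rest + duration I x
            ≡⟨ cong (λ z → a + z + duration I x) (≡.trans (cong (_+ rest) credit-before) (+-identityˡ rest)) ⟨
          a + (credit (x ∷ []) + rest) + duration I x
            ≤⟨ +-monoˡ-≤ _ elapsed-rest ⟩
          s + duration I x ∎
      }

  ∈⇒↭∷ : ∀ {a} {A : Set a} {x : A} {xs} → x ∈ xs → ∃[ ys ] xs ↭ x ∷ ys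
  ∈⇒↭∷ x∈xs with ∈-∃++ x∈xs
  ... | ys , zs , refl = _ , shift _ ys zs

  mutual
    -- Induction along the schedule. The order of `Q` is immaterial to both the bound and the
    -- invariant, so the job of the next entry may be moved to the front.
    lowerBound≤cost : ∀ {a τ Q S} → Sequential I τ S → Pending a τ Q S → lowerBound a Q ≤ cost I S
    lowerBound≤cost {Q = []} [] pend = ≤-reflexive (+-identityˡ 0#)
    lowerBound≤cost {Q = _ ∷ _} [] pend with plan pend (here refl)
    ... | untested ()
    ... | tested ()
    ... | pending ()
    lowerBound≤cost {Q = Q} (cons {s = s} {x} {S} τ≤s seq) pend with member? Fin._≟_ (job x) Q
    -- A job outside `Q` has no tasks left, but `x` is one of its tasks.
    ... | no x∉Q with ≡.trans (sym (tasksOf-accept s x S)) (absent pend x∉Q)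
    ...   | ()
    lowerBound≤cost (cons τ≤s seq) pend | yes x∈Q with ∈⇒↭∷ x∈Q
    ... | Q′ , Q↭ = ≤-trans (≤-reflexive (lowerBound-↭ Q↭))
                            (lowerBound≤cost-∷ τ≤s seq (Pending-↭ Q↭ pend))

    -- A test adds nothing to the cost and makes its job `pending`. Any other task finishes its job,
    -- and the time spent on the job is then one of the two arguments of the minimum `p*`.
    lowerBound≤cost-∷ : ∀ {a τ s x Q S} → τ ≤ s → Sequential I (s + duration I x) S →
                        Pending a τ (job x ∷ Q) ((s , x) ∷ S) →
                        lowerBound a (job x ∷ Q) ≤ cost I ((s , x) ∷ S)
    lowerBound≤cost-∷ {x = test i} τ≤s seq pend with plan-head τ≤s pend
    ... | untested ()
    ... | pending ()
    ... | tested eq = ≤-trans (lowerBound≤cost seq (Pending-test τ≤s pend refl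
            (cong credit (∷-injectiveʳ eq)) (pending (∷-injectiveʳ eq))))
            (≤-reflexive (sym (+-identityˡ _)))
    lowerBound≤cost-∷ {x = execute i} τ≤s seq pend with plan-head τ≤s pend
    ... | untested ()
    ... | tested ()
    ... | pending eq = finish τ≤s seq pend refl (∷-injectiveʳ eq) (x⊓y≤y _ _)
    lowerBound≤cost-∷ {x = executeUntested i} τ≤s seq pend with plan-head τ≤s pend
    ... | tested ()
    ... | pending ()
    ... | untested eq = finish τ≤s seq pend refl (∷-injectiveʳ eq)
            (≤-trans (x⊓y≤x _ _) (≤-reflexive (sym (+-identityˡ _))))

    -- By the invariant after `x`, with the credits dropped, `x` ends no earlier than
    -- `a + p* (job x)`. This pays for the first term of `lowerBound-∷`, and the induction
    -- hypothesis pays for the rest.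
    finish : ∀ {a τ s x Q S} → τ ≤ s → Sequential I (s + duration I x) S →
             Pending a τ (job x ∷ Q) ((s , x) ∷ S) →
             completionTime I (s , x) ≡ s + duration I x →
             tasksOf I (job x) S ≡ [] → p* (job x) ≤ credit (x ∷ []) + duration I x →
             lowerBound a (job x ∷ Q) ≤ cost I ((s , x) ∷ S)
    finish {a} {s = s} {x} {Q} {S} τ≤s seq pend eq done p*≤ = begin
      lowerBound a (job x ∷ Q)
        ≤⟨ lowerBound-∷ Q ⟩
      a + p* (job x) + lowerBound (a + p* (job x)) Q
        ≤⟨ +-mono-≤
            (≤-trans (x≤x+y (sum-nonNegative (λ j → credit-nonNegative (tasksOf I j S)) Q))
                     (elapsed pend′))
            (lowerBound≤cost seq pend′) ⟩
      s + duration I x + cost I S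
        ≡⟨ cong (_+ cost I S) eq ⟨
      cost I ((s , x) ∷ S) ∎
      where pend′ = Pending-finish τ≤s pend done p*≤

  total-p*≤cost : ∀ {S} → Feasible I S → total p* (allFin n) ≤ cost I S
  total-p*≤cost {S} feasible = ≤-trans
    -- The summands of `lowerBound 0#` carry an additional `0#`.
    (+-monoˡ-≤ _ (sum-mono (All.universal (λ j → x≤y+x ≤-refl) (allFin n))))
    (lowerBound≤cost sequential record
      { unique  = allFin⁺ n
      ; plan    = λ {j} _ → initialPlan j
      ; absent  = λ {j} j∉ → contradiction (∈-allFin j) j∉
      ; elapsed = ≤-reflexive (≡.trans (+-identityˡ _) (≡.trans
          (sum-cong (All.universal initialCredit (allFin n))) (sum-zero (allFin n))))
      })
    where
    open Feasible feasible
    initialPlan : ∀ j → Plan j (tasksOf I j S)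
    initialPlan j with complete j
    ... | inj₁ eq = untested eq
    ... | inj₂ eq = tested eq
    initialCredit : ∀ j → credit (tasksOf I j S) ≡ 0#
    initialCredit j with complete j
    ... | inj₁ eq = cong credit eq
    ... | inj₂ eq = cong credit eq

-- The upper bound on the cost of the algorithm for fixed random choices.

module AlgorithmUpperBound {c ℓ : Level} (F : OrderedField c ℓ) {n : ℕ}
                           (I : Scheduling.Instance F n) (β : OrderedField.Carrier F)
                           (0<β : OrderedField._<_ F (OrderedField.0# F) β) where
  open OrderedField F
  open OrderedFieldProperties F
  open Scheduling F
  open Instance I
  open RPCP β I
  open PartialOrderReasoning poset

  -- These are the two values of the variable q. When one job of a pair finishes, `β * t j` covers
  -- the case that `j` still awaits its test, and `(1# + 1# / β) * (t j + p j)` the case that `j`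
  -- finishes after its weight rose to `t j + p j`. The term `2# * t j + p j` covers the case that
  -- `j` was tested and still waits, or finishes with largest weight `β * t j`.
  testedBound untestedBound : Fin n → Carrier
  testedBound j   = (2# * t j + p j) ⊔ (β * t j) ⊔ ((1# + 1# / β) * (t j + p j))
  untestedBound j = (1# + 1# / β) * u j

  bound : Task n → Carrier
  bound (test j)            = testedBound j
  bound (execute j)         = testedBound j
  bound (executeUntested j) = untestedBound j

  -- A queued task encodes the state of its job: the time already devoted to the job and the time
  -- that it will still take.
  spent remaining : Task n → Carrier
  spent (execute j) = t j
  spent _           = 0#
  remaining (test j)            = t j + p j
  remaining (execute j)         = p j
  remaining (executeUntested j) = u j

  -- The largest weight with which the job has been in the queue so far.
  threshold : Task n → Carrier
  threshold (test j)            = β * t j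
  threshold (execute j)         = (β * t j) ⊔ (t j + p j)
  threshold (executeUntested j) = u j

  -- A test that has been run was extracted while the other job was in the
  -- queue, with no smaller weight.
  Compatible : Task n → Task n → Set ℓ
  Compatible x y = β * spent y ≤ threshold x × β * spent x ≤ threshold y

  0≤u : ∀ j → 0# ≤ u j
  0≤u j = ≤-trans (0≤p j) (p≤u j)

  0≤βt : ∀ j → 0# ≤ β * t j
  0≤βt j = *-nonNegative (proj₁ 0<β) (0≤t j)

  0≤1/β : 0# ≤ 1# / β
  0≤1/β = *-nonNegative 0≤1 (⁻¹-nonNegative 0<β)

  spent-nonNegative : ∀ x → 0# ≤ spent x
  spent-nonNegative (test _)            = ≤-refl
  spent-nonNegative (execute j)         = 0≤t j
  spent-nonNegative (executeUntested _) = ≤-refl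

  weight≤threshold : ∀ x → weight x ≤ threshold x
  weight≤threshold (test _)            = ≤-refl
  weight≤threshold (execute _)         = x≤y⊔x _ _
  weight≤threshold (executeUntested _) = ≤-refl

  threshold-nonNegative : ∀ x → 0# ≤ threshold x
  threshold-nonNegative (test j)            = 0≤βt j
  threshold-nonNegative (execute j)         = ≤-trans (0≤βt j) (x≤x⊔y _ _)
  threshold-nonNegative (executeUntested j) = 0≤u j

  2t+p≤testedBound : ∀ j → t j + p j + t j ≤ testedBound j
  2t+p≤testedBound j = begin
    t j + p j + t j  ≡⟨ solve 2 (λ t p → t :+ p :+ t := t :+ t :+ p) refl (t j) (p j) ⟩
    t j + t j + p j  ≡⟨ cong (_+ p j) (2#*x≡x+x (t j)) ⟨
    2# * t j + p j   ≤⟨ x≤x⊔y _ _ ⟩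
    (2# * t j + p j) ⊔ (β * t j)  ≤⟨ x≤x⊔y _ _ ⟩
    testedBound j    ∎

  βt≤testedBound : ∀ j → β * t j ≤ testedBound j
  βt≤testedBound j = ≤-trans (x≤y⊔x _ _) (x≤x⊔y _ _)

  [1+1/β]*x≡x+1/β*x : ∀ x → (1# + 1# / β) * x ≡ x + 1# / β * x
  [1+1/β]*x≡x+1/β*x x = ≡.trans (distribʳ x 1# (1# / β)) (cong (_+ 1# / β * x) (*-identityˡ x))

  -- This is the source of the factor `1# + 1# / β`: a test of weight `β * y` that precedes weight
  -- `x` takes at most the time `1# / β * x`.
  x+y≤[1+1/β]*x : ∀ {x y} → β * y ≤ x → x + y ≤ (1# + 1# / β) * x
  x+y≤[1+1/β]*x {x} βy≤x = ≤-trans (+-monoʳ-≤ x (x*y≤z⇒y≤z/x 0<β βy≤x))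
                                   (≤-reflexive (sym ([1+1/β]*x≡x+1/β*x x)))

  u≤untestedBound : ∀ j → u j ≤ untestedBound j
  u≤untestedBound j = ≤-trans (x≤x+y (*-nonNegative 0≤1/β (0≤u j)))
                              (≤-reflexive (sym ([1+1/β]*x≡x+1/β*x (u j))))

  remaining≤bound : ∀ x → remaining x ≤ bound x
  remaining≤bound (test j)            = ≤-trans (x≤x+y (0≤t j)) (2t+p≤testedBound j)
  remaining≤bound (execute j)         =
    ≤-trans (≤-trans (x≤y+x (0≤t j)) (x≤x+y (0≤t j))) (2t+p≤testedBound j)
  remaining≤bound (executeUntested j) = u≤untestedBound j

  -- Here `y` is the job that finishes later: it is delayed by a task of weight `w` that was
  -- preferred to it, and may have delayed the other job by its own test.
  weight+spent≤later : ∀ {w} y → w ≤ weight y → w + spent y ≤ bound y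
  weight+spent≤later (test j) w≤ =
    ≤-trans (≤-reflexive (+-identityʳ _)) (≤-trans w≤ (βt≤testedBound j))
  weight+spent≤later (execute j) w≤ = ≤-trans (+-monoˡ-≤ (t j) w≤) (2t+p≤testedBound j)
  weight+spent≤later (executeUntested j) w≤ =
    ≤-trans (≤-reflexive (+-identityʳ _)) (≤-trans w≤ (u≤untestedBound j))

  data Completing : Task n → Set where
    execute         : ∀ j → Completing (execute j)
    executeUntested : ∀ j → Completing (executeUntested j)

  -- Here `x` finishes first, and `e` is the time by which the test of the other job has delayed it.
  weight+spent≤bound : ∀ {x e} → Completing x → β * e ≤ threshold x → weight x + e ≤ bound x
  weight+spent≤bound (executeUntested j) βe≤u = x+y≤[1+1/β]*x βe≤u
  weight+spent≤bound {e = e} (execute j) βe≤ with ⊔-sel (β * t j) (t j + p j)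
  -- The largest weight was that of the test, so `e` is at most `t j`.
  ... | inj₁ eq = ≤-trans (+-monoʳ-≤ _ (*-cancelˡ-≤ 0<β (≤-trans βe≤ (≤-reflexive eq))))
                          (2t+p≤testedBound j)
  -- The largest weight was that of the execution, so `e` is at most `1# / β * (t j + p j)`.
  ... | inj₂ eq = ≤-trans (x+y≤[1+1/β]*x (≤-trans βe≤ (≤-reflexive eq))) (x≤y⊔x _ _)

  -- At completion the weight equals the whole time devoted to the job, so comparing weights bounds
  -- the delay inflicted on the other jobs.
  weight≡duration+spent : ∀ {x} → Completing x → weight x ≡ duration I x + spent x
  weight≡duration+spent (execute j)         = +-comm (t j) (p j)
  weight≡duration+spent (executeUntested j) = sym (+-identityʳ (u j))

  -- When `x` finishes, the mutual delay of the pair is settled: all the work on `x` has delayed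
  -- `y`, and only the test of `y`, if already run, has delayed `x`.
  duration+spent≤bounds : ∀ {x} y → Completing x → weight x ≤ weight y → Compatible x y →
                          duration I x + (spent x + spent y) ≤ bound x ⊓ bound y
  duration+spent≤bounds {x} y fin w≤ (βy≤ , _) = begin
    duration I x + (spent x + spent y)  ≡⟨ +-assoc _ _ _ ⟨
    duration I x + spent x + spent y    ≡⟨ cong (_+ spent y) (weight≡duration+spent fin) ⟨
    weight x + spent y
      ≤⟨ ⊓-glb (weight+spent≤bound fin βy≤) (weight+spent≤later y w≤) ⟩
    bound x ⊓ bound y                   ∎

  -- Thresholds only grow when a test becomes an execution, and the newly spent `t i` is controlled
  -- because the test of `i` was extracted while `y` was waiting.
  Compatible-test : ∀ {i} y → β * t i ≤ weight y → Compatible (test i) y → Compatible (execute i) y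
  Compatible-test y w≤ (βy≤ , _) =
    ≤-trans βy≤ (x≤x⊔y _ _) , ≤-trans w≤ (weight≤threshold y)

  -- `spentPairs` is the delay that unfinished jobs have already caused each other through their
  -- tests; `boundPairs` is the allowance for their mutual delay over the whole run.
  spentPairs boundPairs : List (Task n) → Carrier
  spentPairs = pairSum (λ x y → spent x + spent y)
  boundPairs = pairSum (λ x y → bound x ⊓ bound y)

  -- For each waiting `y`, the duration of `x` postpones `y`, and the delay `spent x + spent y`
  -- recorded for the pair is released. The allowance `bound x ⊓ bound y` pays for both.
  finish-≤ : ∀ {τ x Q} S → Completing x → All (λ y → weight x ≤ weight y) Q →
             All (Compatible x) Q →
             cost I S + spentPairs Q ≤
               sum (λ y → τ + duration I x + remaining y) Q + boundPairs Q →
             τ + duration I x + cost I S + spentPairs (x ∷ Q) ≤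
               τ + duration I x + sum (λ y → τ + remaining y) Q + boundPairs (x ∷ Q)
  finish-≤ {τ} {x} {Q} S fin w≤ compat ih = begin
    d + cost I S + (sum (λ y → spent x + spent y) Q + spentPairs Q)
      ≡⟨ solve 4 (λ a b c d → a :+ b :+ (c :+ d) := a :+ (b :+ d :+ c)) refl d _ _ _ ⟩
    d + (cost I S + spentPairs Q + sum (λ y → spent x + spent y) Q)
      ≤⟨ +-monoʳ-≤ d (+-monoˡ-≤ _ ih) ⟩
    d + (sum (λ y → d + remaining y) Q + boundPairs Q + sum (λ y → spent x + spent y) Q)
      ≡⟨ solve 4 (λ a b c d → a :+ (b :+ c :+ d) := a :+ (b :+ d :+ c)) refl d _ _ _ ⟩
    d + (sum (λ y → d + remaining y) Q + sum (λ y → spent x + spent y) Q + boundPairs Q)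
      ≡⟨ cong (λ s → d + (s + boundPairs Q)) (sum-+ _ _ Q) ⟨
    d + (sum (λ y → d + remaining y + (spent x + spent y)) Q + boundPairs Q)
      ≤⟨ +-monoʳ-≤ d (+-monoˡ-≤ _ (sum-mono (All.zipWith (λ {y} → pointwise y) (w≤ , compat)))) ⟩
    d + (sum (λ y → τ + remaining y + bound x ⊓ bound y) Q + boundPairs Q)
      ≡⟨ cong (λ s → d + (s + boundPairs Q)) (sum-+ _ _ Q) ⟩
    d + (sum (λ y → τ + remaining y) Q + sum (λ y → bound x ⊓ bound y) Q + boundPairs Q)
      ≡⟨ solve 4 (λ a b c d → a :+ (b :+ c :+ d) := a :+ b :+ (c :+ d)) refl d _ _ _ ⟩
    d + sum (λ y → τ + remaining y) Q + boundPairs (x ∷ Q) ∎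
    where
    d = τ + duration I x
    pointwise : ∀ y → weight x ≤ weight y × Compatible x y →
                d + remaining y + (spent x + spent y) ≤ τ + remaining y + bound x ⊓ bound y
    pointwise y (w≤y , compat-y) = begin
      τ + duration I x + remaining y + (spent x + spent y)
        ≡⟨ solve 4 (λ a b c d → a :+ b :+ c :+ d := a :+ c :+ (b :+ d)) refl τ _ _ _ ⟩
      τ + remaining y + (duration I x + (spent x + spent y))
        ≤⟨ +-monoʳ-≤ _ (duration+spent≤bounds y fin w≤y compat-y) ⟩
      τ + remaining y + bound x ⊓ bound y ∎

  -- A test leaves the balance of the invariant unchanged: for each other job, `t i` enters the
  -- starting time on the right and the recorded delay on the left. Adding `B` to both sides avoids
  -- subtraction.
  test-≤ : ∀ {τ i} Q S →
           cost I S + spentPairs (execute i ∷ Q) ≤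
             sum (λ y → τ + t i + remaining y) (execute i ∷ Q) + boundPairs (execute i ∷ Q) →
           0# + cost I S + spentPairs (test i ∷ Q) ≤
             sum (λ y → τ + remaining y) (test i ∷ Q) + boundPairs (test i ∷ Q)
  test-≤ {τ} {i} Q S ih = +-cancelʳ-≤ B (begin
    0# + cost I S + (A + E) + B
      ≡⟨ cong (λ s → s + (A + E) + B) (+-identityˡ _) ⟩
    cost I S + (A + E) + B
      ≡⟨ solve 4 (λ c a e b → c :+ (a :+ e) :+ b := c :+ e :+ (b :+ a)) refl (cost I S) A E B ⟩
    cost I S + E + (B + A)
      ≡⟨ cong (cost I S + E +_) shift-test ⟩
    cost I S + E + (A′ + B₀)
      ≡⟨ solve 4 (λ c a e b → c :+ e :+ (a :+ b) := c :+ (a :+ e) :+ b) refl (cost I S) A′ E B₀ ⟩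
    cost I S + (A′ + E) + B₀
      -- `M` also stands for the pairs of `execute i ∷ Q`, because both tasks of a tested job have
      -- the same `bound`.
      ≤⟨ +-monoˡ-≤ B₀ ih ⟩
    τ + t i + p i + B + M + B₀
      ≡⟨ solve 6 (λ τ t p b m b₀ → τ :+ t :+ p :+ b :+ m :+ b₀ :=
                                   τ :+ (t :+ p) :+ b₀ :+ m :+ b) refl τ (t i) (p i) B M B₀ ⟩
    τ + (t i + p i) + B₀ + M + B ∎)
    where
    A  = sum (λ y → 0# + spent y) Q
    A′ = sum (λ y → t i + spent y) Q
    B  = sum (λ y → τ + t i + remaining y) Q
    B₀ = sum (λ y → τ + remaining y) Q
    E  = spentPairs Q
    M  = boundPairs (test i ∷ Q)
    pointwise : ∀ y → τ + t i + remaining y + (0# + spent y) ≡ t i + spent y + (τ + remaining y)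
    pointwise y = ≡.trans (cong (τ + t i + remaining y +_) (+-identityˡ (spent y)))
      (solve 4 (λ τ t r s → τ :+ t :+ r :+ s := t :+ s :+ (τ :+ r)) refl τ (t i) (remaining y) (spent y))
    shift-test : B + A ≡ A′ + B₀
    shift-test = ≡.trans (sym (sum-+ _ _ Q))
      (≡.trans (sum-cong (All.universal pointwise Q)) (sum-+ _ _ Q))

  mutual
    -- The invariant of the run: the cost still to come, plus the mutual delay already caused among
    -- the unfinished jobs, is at most their undelayed completion times counted from `τ` plus the
    -- full allowance for every pair.
    run-≤ : ∀ {τ Q S} → Run τ Q S → AllPairs Compatible Q →
            cost I S + spentPairs Q ≤ sum (λ x → τ + remaining x) Q + boundPairs Q
    run-≤ stop _ = ≤-refl
    run-≤ {τ} {Q} (step {x = x} {Q′} {S} Q↭ w≤ run) compat = begin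
      cost I ((τ , x) ∷ S) + spentPairs Q
        ≡⟨ cong (cost I ((τ , x) ∷ S) +_) (pairSum-↭ (λ y z → +-comm (spent y) (spent z)) Q↭) ⟩
      cost I ((τ , x) ∷ S) + spentPairs (x ∷ Q′)
        ≤⟨ run-∷-≤ w≤ run (Permutation.AllPairs-resp-↭ (setoid _) (λ (a , b) → b , a) (resp₂ _)
             (↭⇒↭ₛ Q↭) compat) ⟩
      sum (λ y → τ + remaining y) (x ∷ Q′) + boundPairs (x ∷ Q′)
        ≡⟨ cong₂ _+_ (sum-↭ _ Q↭) (pairSum-↭ (λ y z → ⊓-comm (bound y) (bound z)) Q↭) ⟨
      sum (λ y → τ + remaining y) Q + boundPairs Q ∎

    run-∷-≤ : ∀ {τ x Q S} → All (λ y → weight x ≤ weight y) Q →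
             Run (τ + duration I x) (inserted x ++ Q) S →
             AllPairs Compatible (x ∷ Q) →
             cost I ((τ , x) ∷ S) + spentPairs (x ∷ Q) ≤
               sum (λ y → τ + remaining y) (x ∷ Q) + boundPairs (x ∷ Q)
    run-∷-≤ {x = test i} {Q} {S} w≤ run (compat ∷ compats) = test-≤ Q S (run-≤ run
      (All.zipWith (λ {y} (w≤y , compat-y) → Compatible-test y w≤y compat-y) (w≤ , compat) ∷ compats))
    run-∷-≤ {x = execute j} {S = S} w≤ run (compat ∷ compats) =
      finish-≤ S (execute j) w≤ compat (run-≤ run compats)
    run-∷-≤ {x = executeUntested j} {S = S} w≤ run (compat ∷ compats) =
      finish-≤ S (executeUntested j) w≤ compat (run-≤ run compats)

  choiceBound : Vec Bool n → Fin n → Carrier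
  choiceBound v j = if lookup v j then testedBound j else untestedBound j

  cost≤total-choiceBound : ∀ v {S} → Run 0# (initialQueue v) S →
                           cost I S ≤ total (choiceBound v) (allFin n)
  cost≤total-choiceBound v {S} run = begin
    cost I S
      ≤⟨ x≤x+y (pairSum-nonNegative
           (λ x y → +-nonNegative (spent-nonNegative x) (spent-nonNegative y)) Q) ⟩
    cost I S + spentPairs Q
      -- At the start nothing has been spent, so all pairs are `Compatible`.
      ≤⟨ run-≤ run (AllPairs.map⁺ (AllPairs.tabulate⁺ {f = id} (λ {i} {j} _ →
           βspent≤ j (initial i) , βspent≤ i (initial j)))) ⟩
    sum (λ x → 0# + remaining x) Q + boundPairs Q
      ≤⟨ +-monoˡ-≤ _ (sum-mono (All.universal
           (λ x → ≤-trans (≤-reflexive (+-identityˡ _)) (remaining≤bound x)) Q)) ⟩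
    total bound Q
      ≡⟨ total-map bound initial (allFin n) ⟩
    total (bound ∘ initial) (allFin n)
      ≤⟨ total-mono (λ j → ≤-reflexive (bound-initial j)) (allFin n) ⟩
    total (choiceBound v) (allFin n) ∎
    where
    Q = initialQueue v
    initial : Fin n → Task n
    initial j = if lookup v j then test j else executeUntested j
    bound-initial : ∀ j → bound (initial j) ≡ choiceBound v j
    bound-initial j with lookup v j
    ... | true  = refl
    ... | false = refl
    spent-initial : ∀ j → spent (initial j) ≡ 0#
    spent-initial j with lookup v j
    ... | true  = refl
    ... | false = refl
    βspent≤ : ∀ i x → β * spent (initial i) ≤ threshold x
    βspent≤ i x = ≤-trans (≤-reflexive (≡.trans (cong (β *_) (spent-initial i)) (zeroʳ β)))
                          (threshold-nonNegative x)

-- The comparison of expected cost and optimum.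

theorem12 : ∀ {c ℓ} (F : OrderedField c ℓ) →
    let open OrderedField F
        open Scheduling F
    in ∀ {n : ℕ} (I : Instance (suc n)) (β : Carrier) →
    let open Instance I
        open RPCP β I
    in 0# < β →
    (∀ k → 0# < t k) →
    (∀ k → 0# < u k) →
    (∀ k → 0# ≤ ℙ k × ℙ k ≤ 1#) →
    (A : Execution) →
    ∀ OPT → IsOPT I OPT →
    expectedCost A ≤ maximum jobRatio * cost I OPT
theorem12 F {n} I β 0<β 0<t 0<u 0≤ℙ≤1 A OPT isOPT = begin
  expectedCost A
    ≤⟨ 𝔼-mono 0≤ℙ≤1 (λ v → cost≤total-choiceBound v (Execution.isRun A v)) ⟩
  𝔼 ℙ (λ v → total (choiceBound v) jobs)
    ≤⟨ 𝔼-total 0≤ℙ≤1 choiceBound jobs ⟩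
  total (λ k → 𝔼 ℙ (λ v → choiceBound v k)) jobs
    ≤⟨ total-mono 𝔼-choiceBound≤ jobs ⟩
  total (λ k → maximum jobRatio * p* k) jobs
    ≤⟨ total-*-≤ (maximum jobRatio) p* jobs ⟩
  maximum jobRatio * total p* jobs
    -- The optimum enters only here, as a feasible schedule.
    ≤⟨ *-monoˡ-≤ 0≤maximum (total-p*≤cost (IsOPT.feasible isOPT)) ⟩
  maximum jobRatio * cost I OPT ∎
  where
  open OrderedField F
  open OrderedFieldProperties F
  open Scheduling F
  open Instance I
  open RPCP β I
  open Expectation F
  open OptimumLowerBound F I
  open AlgorithmUpperBound F I β 0<β
  open PartialOrderReasoning poset

  jobs : List (Fin (suc n))
  jobs = allFin (suc n)

  -- This allows `p* k` to be cancelled in `jobRatio k`, since inverses are specified only for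
  -- nonzero elements.
  0<p* : ∀ k → 0# < p* k
  0<p* k with ⊓-sel (u k) (t k + p k)
  ... | inj₁ eq = subst (0# <_) (sym eq) (0<u k)
  ... | inj₂ eq = subst (0# <_) (sym eq)
    (+-nonNegative (0≤t k) (0≤p k) , λ 0≡t+p →
      proj₂ (0<t k) (≤-antisym (0≤t k) (≤-trans (x≤x+y (0≤p k)) (≤-reflexive (sym 0≡t+p)))))

  numerator : Fin (suc n) → Carrier
  numerator k = untestedBound k * (1# - ℙ k) + testedBound k * ℙ k

  𝔼-choiceBound≤ : ∀ k → 𝔼 ℙ (λ v → choiceBound v k) ≤ maximum jobRatio * p* k
  𝔼-choiceBound≤ k = begin
    𝔼 ℙ (λ v → choiceBound v k)
      ≡⟨ 𝔼-lookup ℙ (λ b → if b then testedBound k else untestedBound k) k ⟩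
    ℙ k * testedBound k + (1# - ℙ k) * untestedBound k
      ≡⟨ solve 4 (λ a b c d → a :* b :+ c :* d := d :* c :+ b :* a) refl
           (ℙ k) (testedBound k) (1# - ℙ k) (untestedBound k) ⟩
    numerator k
      ≡⟨ x/y*y≡x (numerator k) (0<p* k) ⟨
    jobRatio k * p* k
      ≤⟨ *-monoʳ-≤ (proj₁ (0<p* k)) (f≤maximum jobRatio k) ⟩
    maximum jobRatio * p* k ∎

  -- One nonnegative ratio suffices, and job `zero` exists because there are `suc n` jobs.
  0≤maximum : 0# ≤ maximum jobRatio
  0≤maximum = ≤-trans
    (*-nonNegative
      (+-nonNegative
        (*-nonNegative (≤-trans (0≤u zero) (u≤untestedBound zero))
                       (x≤y⇒0≤y-x (proj₂ (0≤ℙ≤1 zero))))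
        (*-nonNegative (≤-trans (0≤βt zero) (βt≤testedBound zero)) (proj₁ (0≤ℙ≤1 zero))))
      (⁻¹-nonNegative (0<p* zero)))
    (f≤maximum jobRatio zero)
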